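{- Let $U$ be a unitary operator on the state space $(\mathbb{C}^2)^{\otimes n}$ of $n$ qubits, and let $A$ and $B$ be operators on the same space such that $U : A \to B$ in the Heisenberg interpretation, i.e. $U A U^{\dagger} = B$. Then $U$ takes every eigenstate of $A$ to an eigenstate of $B$: for every eigenstate $|\psi\rangle$ of $A$, the vector $U|\psi\rangle$ is an eigenstate of $B$.
   Context: In the Heisenberg representation, a unitary $U$ acts on operators by conjugation, $N \mapsto U N U^{\dagger}$, and the judgement $U : A \to B$ means $B = U A U^{\dagger}$. An eigenstate of an operator $N$ is a nonzero vector $|\psi\rangle$ with $N|\psi\rangle = \lambda|\psi\rangle$ for some $\lambda \in \mathbb{C}$. -}

module Defs where

open import Algebra.Bundles using (CommutativeRing)
open import Data.Fin.Base using (Fin)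
import Data.Fin.Properties as Fin
open import Data.Maybe.Base using (nothing)
open import Data.Nat.Base as ℕ using (ℕ; _⊔_; _^_)
import Data.Nat.Properties as ℕₚ
open import Data.Product.Base using (Σ; ∃; _×_; _,_; proj₁; proj₂)
open import Data.Rational.Base as ℚ using (ℚ; 0ℚ; 1ℚ; ½; ∣_∣)
import Data.Rational.Properties as ℚₚ
open import Data.Vec.Functional using (Vector)
open import Level using (0ℓ)
open import Relation.Binary.PropositionalEquality
  using (_≡_; refl; sym; trans; cong; cong₂; subst)
open import Relation.Nullary using (¬_; yes; no)

import Algebra.Properties.CommutativeMonoid.Sum
import Data.Vec.Functional.Relation.Binary.Equality.Setoid
import Tactic.RingSolver.Core.AlmostCommutativeRing as ACR
open import Tactic.RingSolver using (solve-∀)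

private
  module ℚ-Estimates where
    open import Data.Rational.Base using (_+_; _*_; _-_; -_; _<_; _≤_)
    open ℚₚ.≤-Reasoning

    ℚ-acr : ACR.AlmostCommutativeRing 0ℓ 0ℓ
    ℚ-acr = ACR.fromCommutativeRing ℚₚ.+-*-commutativeRing (λ _ → nothing)

    half : ∀ ε → ½ * ε + ½ * ε ≡ ε
    half ε = trans (sym (ℚₚ.*-distribʳ-+ ε ½ ½)) (ℚₚ.*-identityˡ ε)

    *-pos : ∀ {p q} → 0ℚ < p → 0ℚ < q → 0ℚ < p * q
    *-pos {p} {q} 0<p 0<q = subst (_< p * q) (ℚₚ.*-zeroʳ p)
      (ℚₚ.*-monoʳ-<-pos p {{ℚ.positive 0<p}} 0<q)

    half-pos : ∀ {ε} → 0ℚ < ε → 0ℚ < ½ * ε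
    half-pos = *-pos (ℚₚ.positive⁻¹ ½)

    +-close : ∀ {p q ε} → ∣ p ∣ < ½ * ε → ∣ q ∣ < ½ * ε → ∣ p + q ∣ < ε
    +-close {p} {q} {ε} hp hq = begin-strict
      ∣ p + q ∣         ≤⟨ ℚₚ.∣p+q∣≤∣p∣+∣q∣ p q ⟩
      ∣ p ∣ + ∣ q ∣     <⟨ ℚₚ.+-mono-< hp hq ⟩
      ½ * ε + ½ * ε     ≡⟨ half ε ⟩
      ε                 ∎

    telescope : ∀ a b c → (a - b) + (b - c) ≡ a - c
    telescope a b c = begin-equality
      (a - b) + (b - c)     ≡⟨ ℚₚ.+-assoc a (- b) (b - c) ⟩
      a + (- b + (b - c))   ≡⟨ cong (a +_) (ℚₚ.+-assoc (- b) b (- c)) ⟨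
      a + ((- b + b) - c)   ≡⟨ cong (λ t → a + (t - c)) (ℚₚ.+-inverseˡ b) ⟩
      a + (0ℚ - c)          ≡⟨ cong (a +_) (ℚₚ.+-identityˡ (- c)) ⟩
      a - c                 ∎

    close-trans : ∀ {a b c ε} → ∣ a - b ∣ < ½ * ε → ∣ b - c ∣ < ½ * ε → ∣ a - c ∣ < ε
    close-trans {a} {b} {c} {ε} h k =
      subst (λ t → ∣ t ∣ < ε) (telescope a b c) (+-close {a - b} {b - c} h k)

    close-sym : ∀ {a b ε} → ∣ a - b ∣ < ε → ∣ b - a ∣ < ε
    close-sym {a} {b} {ε} = subst (_< ε) (begin-equality
      ∣ a - b ∣          ≡⟨ ℚₚ.∣-p∣≡∣p∣ (a - b) ⟨
      ∣ - (a - b) ∣      ≡⟨ cong ∣_∣ (lemma a b) ⟩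
      ∣ b - a ∣          ∎)
      where
      lemma : ∀ a b → - (a - b) ≡ b - a
      lemma = solve-∀ ℚ-acr

    +-diff : ∀ {a b c d ε} → ∣ a - c ∣ < ½ * ε → ∣ b - d ∣ < ½ * ε →
             ∣ (a + b) - (c + d) ∣ < ε
    +-diff {a} {b} {c} {d} {ε} h k =
      subst (λ t → ∣ t ∣ < ε) (lemma a b c d) (+-close {a - c} {b - d} h k)
      where
      lemma : ∀ a b c d → (a - c) + (b - d) ≡ (a + b) - (c + d)
      lemma = solve-∀ ℚ-acr

    neg-diff : ∀ {a c ε} → ∣ a - c ∣ < ε → ∣ (- a) - (- c) ∣ < ε
    neg-diff {a} {c} {ε} = subst (_< ε)
      (trans (sym (ℚₚ.∣-p∣≡∣p∣ (a - c))) (cong ∣_∣ (ℚₚ.neg-distrib-+ a (- c))))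

    *-small : ∀ {B δ p q} → 0ℚ < B → ∣ p ∣ ≤ B → ∣ q ∣ < δ → ∣ p * q ∣ < B * δ
    *-small {B} {δ} {p} {q} 0<B hp hq = begin-strict
      ∣ p * q ∣      ≡⟨ ℚₚ.∣p*q∣≡∣p∣*∣q∣ p q ⟩
      ∣ p ∣ * ∣ q ∣  ≤⟨ ℚₚ.*-monoʳ-≤-nonNeg ∣ q ∣ {{ℚₚ.∣-∣-nonNeg q}} hp ⟩
      B * ∣ q ∣      <⟨ ℚₚ.*-monoʳ-<-pos B {{ℚ.positive 0<B}} hq ⟩
      B * δ          ∎

    shrink : ∀ {B ε} → 0ℚ < B → 0ℚ < ε → Σ ℚ λ δ → 0ℚ < δ × B * δ ≡ ½ * ε
    shrink {B} {ε} 0<B 0<ε = ℚ.1/ B * (½ * ε)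
      , *-pos (ℚₚ.positive⁻¹ (ℚ.1/ B) {{ℚₚ.1/pos⇒pos B}}) (half-pos 0<ε)
      , trans (sym (ℚₚ.*-assoc B (ℚ.1/ B) (½ * ε)))
          (trans (cong (_* (½ * ε)) (ℚₚ.*-inverseʳ B)) (ℚₚ.*-identityˡ (½ * ε)))
      where instance
        B-pos : ℚ.Positive B
        B-pos = ℚ.positive 0<B
        B-nz : ℚ.NonZero B
        B-nz = ℚₚ.pos⇒nonZero B

    *-diff : ∀ {B δ ε a b c d} → 0ℚ < B → B * δ ≡ ½ * ε → ∣ a ∣ ≤ B → ∣ d ∣ ≤ B →
             ∣ a - c ∣ < δ → ∣ b - d ∣ < δ → ∣ a * b - c * d ∣ < ε
    *-diff {B} {δ} {ε} {a} {b} {c} {d} 0<B eq ha hd h k =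
      subst (λ t → ∣ t ∣ < ε) lemma
        (+-close {a * (b - d)} {d * (a - c)}
          (subst (_ <_) eq (*-small {p = a} 0<B ha k))
          (subst (_ <_) eq (*-small {p = d} 0<B hd h)))
      where
      lemma : a * (b - d) + d * (a - c) ≡ a * b - c * d
      lemma = begin-equality
        a * (b - d) + d * (a - c)
          ≡⟨ cong₂ _+_ (lem₁ a b d) (lem₁′ d a c) ⟩
        (a * b - a * d) + (a * d - c * d)
          ≡⟨ telescope (a * b) (a * d) (c * d) ⟩
        a * b - c * d ∎
        where
        lem₁ : ∀ x y z → x * (y - z) ≡ x * y - x * z
        lem₁ = solve-∀ ℚ-acr
        lem₁′ : ∀ x y z → x * (y - z) ≡ y * x - z * x
        lem₁′ = solve-∀ ℚ-acr

  open ℚ-Estimates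

IsCauchy : (ℕ → ℚ) → Set
IsCauchy x = ∀ ε → 0ℚ ℚ.< ε →
  Σ ℕ λ N → ∀ m n → N ℕ.≤ m → N ℕ.≤ n → ∣ x m ℚ.- x n ∣ ℚ.< ε

-- Equality of reals is _≈ℝ_ below: the difference of the sequences tends to 0.
record ℝ : Set where
  constructor mkℝ
  field
    seq    : ℕ → ℚ
    cauchy : IsCauchy seq

open ℝ public

infix 4 _≈ℝ_
record _≈ℝ_ (x y : ℝ) : Set where
  constructor mk≈ℝ
  field
    converge : ∀ ε → 0ℚ ℚ.< ε →
      Σ ℕ λ N → ∀ n → N ℕ.≤ n → ∣ seq x n ℚ.- seq y n ∣ ℚ.< ε

open _≈ℝ_ public

private
  dist-refl : ∀ {p q ε} → p ≡ q → 0ℚ ℚ.< ε → ∣ p ℚ.- q ∣ ℚ.< ε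
  dist-refl {p} {ε = ε} refl 0<ε =
    subst (λ t → ∣ t ∣ ℚ.< ε) (sym (ℚₚ.+-inverseʳ p)) 0<ε

  ⊔-left : ∀ {M n} N → M ⊔ N ℕ.≤ n → M ℕ.≤ n
  ⊔-left {M} N = ℕₚ.≤-trans (ℕₚ.m≤m⊔n M N)

  ⊔-right : ∀ {N n} M → M ⊔ N ℕ.≤ n → N ℕ.≤ n
  ⊔-right {N} M = ℕₚ.≤-trans (ℕₚ.m≤n⊔m M N)

  eventually-bounded : (x : ℝ) → Σ ℚ λ B → 0ℚ ℚ.< B ×
    Σ ℕ λ N → ∀ n → N ℕ.≤ n → ∣ seq x n ∣ ℚ.≤ B
  eventually-bounded x with cauchy x 1ℚ (ℚₚ.positive⁻¹ 1ℚ)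
  ... | N , close = 1ℚ ℚ.+ ∣ seq x N ∣
    , ℚₚ.+-mono-<-≤ (ℚₚ.positive⁻¹ 1ℚ) (ℚₚ.0≤∣p∣ (seq x N))
    , N , λ n N≤n → begin
        ∣ seq x n ∣
          ≡⟨ cong ∣_∣ (split (seq x n) (seq x N)) ⟨
        ∣ (seq x n ℚ.- seq x N) ℚ.+ seq x N ∣
          ≤⟨ ℚₚ.∣p+q∣≤∣p∣+∣q∣ (seq x n ℚ.- seq x N) (seq x N) ⟩
        ∣ seq x n ℚ.- seq x N ∣ ℚ.+ ∣ seq x N ∣
          ≤⟨ ℚₚ.+-monoˡ-≤ ∣ seq x N ∣ (ℚₚ.<⇒≤ (close n N N≤n ℕₚ.≤-refl)) ⟩
        1ℚ ℚ.+ ∣ seq x N ∣ ∎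
    where
    open ℚₚ.≤-Reasoning
    split : ∀ p q → (p ℚ.- q) ℚ.+ q ≡ p
    split p q = trans (ℚₚ.+-assoc p (ℚ.- q) q)
      (trans (cong (p ℚ.+_) (ℚₚ.+-inverseˡ q)) (ℚₚ.+-identityʳ p))

  common-bound : (x y : ℝ) → Σ ℚ λ B → 0ℚ ℚ.< B × Σ ℕ λ N → ∀ n → N ℕ.≤ n →
    ∣ seq x n ∣ ℚ.≤ B × ∣ seq y n ∣ ℚ.≤ B
  common-bound x y with eventually-bounded x | eventually-bounded y
  ... | B , 0<B , M , hx | C , 0<C , N , hy =
    B ℚ.+ C , ℚₚ.+-mono-< 0<B 0<C , M ⊔ N , λ n p →
      ℚₚ.≤-trans (hx n (⊔-left N p))
        (subst (ℚ._≤ B ℚ.+ C) (ℚₚ.+-identityʳ B) (ℚₚ.+-monoʳ-≤ B (ℚₚ.<⇒≤ 0<C))) ,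
      ℚₚ.≤-trans (hy n (⊔-right M p))
        (subst (ℚ._≤ B ℚ.+ C) (ℚₚ.+-identityˡ C) (ℚₚ.+-monoˡ-≤ C (ℚₚ.<⇒≤ 0<B)))

  abstract
    +-cauchy : ∀ x y → IsCauchy (λ n → seq x n ℚ.+ seq y n)
    +-cauchy x y ε 0<ε with cauchy x (½ ℚ.* ε) (half-pos 0<ε) | cauchy y (½ ℚ.* ε) (half-pos 0<ε)
    ... | M , h | N , k = M ⊔ N , λ m n p q →
      +-diff {seq x m} {seq y m} {seq x n} {seq y n}
        (h m n (⊔-left N p) (⊔-left N q)) (k m n (⊔-right M p) (⊔-right M q))

    neg-cauchy : ∀ x → IsCauchy (λ n → ℚ.- seq x n)
    neg-cauchy x ε 0<ε with cauchy x ε 0<ε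
    ... | N , h = N , λ m n p q → neg-diff {seq x m} {seq x n} (h m n p q)

    *-cauchy : ∀ x y → IsCauchy (λ n → seq x n ℚ.* seq y n)
    *-cauchy x y ε 0<ε with common-bound x y
    ... | B , 0<B , K , bound with shrink 0<B 0<ε
    ... | δ , 0<δ , eq with cauchy x δ 0<δ | cauchy y δ 0<δ
    ... | M , h | N , k = K ⊔ (M ⊔ N) , λ m n p q →
      let p′ = ⊔-right K p
          q′ = ⊔-right K q
      in *-diff {a = seq x m} {seq y m} {seq x n} {seq y n} 0<B eq
           (proj₁ (bound m (⊔-left (M ⊔ N) p))) (proj₂ (bound n (⊔-left (M ⊔ N) q)))
           (h m n (⊔-left N p′) (⊔-left N q′)) (k m n (⊔-right M p′) (⊔-right M q′))

fromℚ : ℚ → ℝ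
fromℚ q = mkℝ (λ _ → q) λ ε 0<ε → 0 , λ _ _ _ _ → dist-refl {q} refl 0<ε

infixl 6 _+ℝ_
_+ℝ_ : ℝ → ℝ → ℝ
x +ℝ y = mkℝ (λ n → seq x n ℚ.+ seq y n) (+-cauchy x y)

infix 8 -ℝ_
-ℝ_ : ℝ → ℝ
-ℝ x = mkℝ (λ n → ℚ.- seq x n) (neg-cauchy x)

infixl 7 _*ℝ_
_*ℝ_ : ℝ → ℝ → ℝ
x *ℝ y = mkℝ (λ n → seq x n ℚ.* seq y n) (*-cauchy x y)

private
  pointwise : ∀ {x y} → (∀ n → seq x n ≡ seq y n) → x ≈ℝ y
  pointwise eq = mk≈ℝ λ ε 0<ε → 0 , λ n _ → dist-refl (eq n) 0<ε

  ≈ℝ-sym : ∀ {x y} → x ≈ℝ y → y ≈ℝ x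
  ≈ℝ-sym {x} {y} (mk≈ℝ h) = mk≈ℝ λ ε 0<ε →
    proj₁ (h ε 0<ε) , λ n p → close-sym {seq x n} {seq y n} (proj₂ (h ε 0<ε) n p)

  ≈ℝ-trans : ∀ {x y z} → x ≈ℝ y → y ≈ℝ z → x ≈ℝ z
  ≈ℝ-trans {x} {y} {z} (mk≈ℝ h) (mk≈ℝ k) = mk≈ℝ go
    where
    go : ∀ ε → 0ℚ ℚ.< ε → Σ ℕ λ N → ∀ n → N ℕ.≤ n → ∣ seq x n ℚ.- seq z n ∣ ℚ.< ε
    go ε 0<ε with h (½ ℚ.* ε) (half-pos 0<ε) | k (½ ℚ.* ε) (half-pos 0<ε)
    ... | M , h′ | N , k′ = M ⊔ N , λ n p →
      close-trans {seq x n} {seq y n} {seq z n} (h′ n (⊔-left N p)) (k′ n (⊔-right M p))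

  +ℝ-cong : ∀ {x y u v} → x ≈ℝ y → u ≈ℝ v → x +ℝ u ≈ℝ y +ℝ v
  +ℝ-cong {x} {y} {u} {v} (mk≈ℝ h) (mk≈ℝ k) = mk≈ℝ go
    where
    go : ∀ ε → 0ℚ ℚ.< ε → Σ ℕ λ N → ∀ n → N ℕ.≤ n →
         ∣ seq (x +ℝ u) n ℚ.- seq (y +ℝ v) n ∣ ℚ.< ε
    go ε 0<ε with h (½ ℚ.* ε) (half-pos 0<ε) | k (½ ℚ.* ε) (half-pos 0<ε)
    ... | M , h′ | N , k′ = M ⊔ N , λ n p →
      +-diff {seq x n} {seq u n} {seq y n} {seq v n} (h′ n (⊔-left N p)) (k′ n (⊔-right M p))

  -ℝ-cong : ∀ {x y} → x ≈ℝ y → -ℝ x ≈ℝ -ℝ y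
  -ℝ-cong {x} {y} (mk≈ℝ h) = mk≈ℝ λ ε 0<ε →
    proj₁ (h ε 0<ε) , λ n p → neg-diff {seq x n} {seq y n} (proj₂ (h ε 0<ε) n p)

  *ℝ-cong : ∀ {x y u v} → x ≈ℝ y → u ≈ℝ v → x *ℝ u ≈ℝ y *ℝ v
  *ℝ-cong {x} {y} {u} {v} (mk≈ℝ h) (mk≈ℝ k) = mk≈ℝ go
    where
    go : ∀ ε → 0ℚ ℚ.< ε → Σ ℕ λ N → ∀ n → N ℕ.≤ n →
         ∣ seq (x *ℝ u) n ℚ.- seq (y *ℝ v) n ∣ ℚ.< ε
    go ε 0<ε with common-bound x v
    ... | B , 0<B , K , bound with shrink 0<B 0<ε
    ... | δ , 0<δ , eq with h δ 0<δ | k δ 0<δ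
    ... | M , h′ | N , k′ = K ⊔ (M ⊔ N) , λ n p →
      let b = bound n (⊔-left (M ⊔ N) p)
          p′ = ⊔-right K p
      in *-diff {a = seq x n} {seq u n} {seq y n} {seq v n} 0<B eq
           (proj₁ b) (proj₂ b) (h′ n (⊔-left N p′)) (k′ n (⊔-right M p′))

ℝ-commutativeRing : CommutativeRing 0ℓ 0ℓ
ℝ-commutativeRing = record
  { Carrier = ℝ
  ; _≈_     = _≈ℝ_
  ; _+_     = _+ℝ_
  ; _*_     = _*ℝ_
  ; -_      = -ℝ_
  ; 0#      = fromℚ 0ℚ
  ; 1#      = fromℚ 1ℚ
  ; isCommutativeRing = record
    { isRing = record
      { +-isAbelianGroup = record
        { isGroup = record
          { isMonoid = record
            { isSemigroup = record
              { isMagma = record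
                { isEquivalence = record
                  { refl  = pointwise (λ _ → refl)
                  ; sym   = ≈ℝ-sym
                  ; trans = ≈ℝ-trans
                  }
                ; ∙-cong = +ℝ-cong
                }
              ; assoc = λ x y z → pointwise λ n → ℚₚ.+-assoc (seq x n) (seq y n) (seq z n)
              }
            ; identity = (λ x → pointwise λ n → ℚₚ.+-identityˡ (seq x n))
                       , (λ x → pointwise λ n → ℚₚ.+-identityʳ (seq x n))
            }
          ; inverse = (λ x → pointwise λ n → ℚₚ.+-inverseˡ (seq x n))
                    , (λ x → pointwise λ n → ℚₚ.+-inverseʳ (seq x n))
          ; ⁻¹-cong = -ℝ-cong
          }
        ; comm = λ x y → pointwise λ n → ℚₚ.+-comm (seq x n) (seq y n)
        }
      ; *-cong = *ℝ-cong
      ; *-assoc = λ x y z → pointwise λ n → ℚₚ.*-assoc (seq x n) (seq y n) (seq z n)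
      ; *-identity = (λ x → pointwise λ n → ℚₚ.*-identityˡ (seq x n))
                   , (λ x → pointwise λ n → ℚₚ.*-identityʳ (seq x n))
      ; distrib = (λ x y z → pointwise λ n → ℚₚ.*-distribˡ-+ (seq x n) (seq y n) (seq z n))
                , (λ x y z → pointwise λ n → ℚₚ.*-distribʳ-+ (seq x n) (seq y n) (seq z n))
      }
    ; *-comm = λ x y → pointwise λ n → ℚₚ.*-comm (seq x n) (seq y n)
    }
  }

infix 9 _+i_
record ℂ : Set where
  constructor _+i_
  field
    re im : ℝ

open ℂ public

infix 4 _≈ℂ_
record _≈ℂ_ (z w : ℂ) : Set where
  constructor mk≈ℂ
  field
    re≈ : re z ≈ℝ re w
    im≈ : im z ≈ℝ im w

open _≈ℂ_ public

0ℂ 1ℂ : ℂ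
0ℂ = fromℚ 0ℚ +i fromℚ 0ℚ
1ℂ = fromℚ 1ℚ +i fromℚ 0ℚ

infixl 6 _+ℂ_
_+ℂ_ : ℂ → ℂ → ℂ
z +ℂ w = (re z +ℝ re w) +i (im z +ℝ im w)

infix 8 -ℂ_
-ℂ_ : ℂ → ℂ
-ℂ z = (-ℝ re z) +i (-ℝ im z)

infixl 7 _*ℂ_
_*ℂ_ : ℂ → ℂ → ℂ
z *ℂ w = (re z *ℝ re w +ℝ -ℝ (im z *ℝ im w)) +i (re z *ℝ im w +ℝ im z *ℝ re w)

conj : ℂ → ℂ
conj z = re z +i (-ℝ im z)

private
  module ℂ-Identities where
    open import Data.Rational.Base using (_+_; _*_; _-_)

    abstract
      *-assoc-re : ∀ a b c d e f →
        (a * c - b * d) * e - (a * d + b * c) * f ≡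
        a * (c * e - d * f) - b * (c * f + d * e)
      *-assoc-re = solve-∀ ℚ-acr

      *-assoc-im : ∀ a b c d e f →
        (a * c - b * d) * f + (a * d + b * c) * e ≡ a * (c * f + d * e) + b * (c * e - d * f)
      *-assoc-im = solve-∀ ℚ-acr

      *-comm-re : ∀ a b c d → a * c - b * d ≡ c * a - d * b
      *-comm-re = solve-∀ ℚ-acr

      *-comm-im : ∀ a b c d → a * d + b * c ≡ c * b + d * a
      *-comm-im = solve-∀ ℚ-acr

      distribˡ-re : ∀ a b c d e f →
        a * (c + e) - b * (d + f) ≡ (a * c - b * d) + (a * e - b * f)
      distribˡ-re = solve-∀ ℚ-acr

      distribˡ-im : ∀ a b c d e f →
        a * (d + f) + b * (c + e) ≡ (a * d + b * c) + (a * f + b * e)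
      distribˡ-im = solve-∀ ℚ-acr

      distribʳ-re : ∀ a b c d e f →
        (c + e) * a - (d + f) * b ≡ (c * a - d * b) + (e * a - f * b)
      distribʳ-re = solve-∀ ℚ-acr

      distribʳ-im : ∀ a b c d e f →
        (c + e) * b + (d + f) * a ≡ (c * b + d * a) + (e * b + f * a)
      distribʳ-im = solve-∀ ℚ-acr

      identityˡ-re : ∀ a b → 1ℚ * a - 0ℚ * b ≡ a
      identityˡ-re a b = trans (cong₂ _-_ (ℚₚ.*-identityˡ a) (ℚₚ.*-zeroˡ b)) (ℚₚ.+-identityʳ a)

      identityˡ-im : ∀ a b → 1ℚ * b + 0ℚ * a ≡ b
      identityˡ-im a b = trans (cong₂ _+_ (ℚₚ.*-identityˡ b) (ℚₚ.*-zeroˡ a)) (ℚₚ.+-identityʳ b)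

      identityʳ-re : ∀ a b → a * 1ℚ - b * 0ℚ ≡ a
      identityʳ-re a b = trans (cong₂ _-_ (ℚₚ.*-identityʳ a) (ℚₚ.*-zeroʳ b)) (ℚₚ.+-identityʳ a)

      identityʳ-im : ∀ a b → a * 0ℚ + b * 1ℚ ≡ b
      identityʳ-im a b = trans (cong₂ _+_ (ℚₚ.*-zeroʳ a) (ℚₚ.*-identityʳ b)) (ℚₚ.+-identityˡ b)

  open ℂ-Identities

  module R = CommutativeRing ℝ-commutativeRing

  r i : ℂ → ℕ → ℚ
  r z = seq (re z)
  i z = seq (im z)

ℂ-commutativeRing : CommutativeRing 0ℓ 0ℓ
ℂ-commutativeRing = record
  { Carrier = ℂ
  ; _≈_     = _≈ℂ_
  ; _+_     = _+ℂ_
  ; _*_     = _*ℂ_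
  ; -_      = -ℂ_
  ; 0#      = 0ℂ
  ; 1#      = 1ℂ
  ; isCommutativeRing = record
    { isRing = record
      { +-isAbelianGroup = record
        { isGroup = record
          { isMonoid = record
            { isSemigroup = record
              { isMagma = record
                { isEquivalence = record
                  { refl  = mk≈ℂ R.refl R.refl
                  ; sym   = λ p → mk≈ℂ (R.sym (re≈ p)) (R.sym (im≈ p))
                  ; trans = λ p q →
                      mk≈ℂ (R.trans (re≈ p) (re≈ q)) (R.trans (im≈ p) (im≈ q))
                  }
                ; ∙-cong = λ p q →
                    mk≈ℂ (R.+-cong (re≈ p) (re≈ q)) (R.+-cong (im≈ p) (im≈ q))
                }
              ; assoc = λ x y z →
                  mk≈ℂ (R.+-assoc (re x) (re y) (re z)) (R.+-assoc (im x) (im y) (im z))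
              }
            ; identity = (λ x → mk≈ℂ (R.+-identityˡ (re x)) (R.+-identityˡ (im x)))
                       , (λ x → mk≈ℂ (R.+-identityʳ (re x)) (R.+-identityʳ (im x)))
            }
          ; inverse = (λ x → mk≈ℂ (R.-‿inverseˡ (re x)) (R.-‿inverseˡ (im x)))
                    , (λ x → mk≈ℂ (R.-‿inverseʳ (re x)) (R.-‿inverseʳ (im x)))
          ; ⁻¹-cong = λ p → mk≈ℂ (R.-‿cong (re≈ p)) (R.-‿cong (im≈ p))
          }
        ; comm = λ x y → mk≈ℂ (R.+-comm (re x) (re y)) (R.+-comm (im x) (im y))
        }
      ; *-cong = λ p q → mk≈ℂ
          (R.+-cong (R.*-cong (re≈ p) (re≈ q)) (R.-‿cong (R.*-cong (im≈ p) (im≈ q))))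
          (R.+-cong (R.*-cong (re≈ p) (im≈ q)) (R.*-cong (im≈ p) (re≈ q)))
      ; *-assoc = λ x y z → mk≈ℂ
          (pointwise λ n → *-assoc-re (r x n) (i x n) (r y n) (i y n) (r z n) (i z n))
          (pointwise λ n → *-assoc-im (r x n) (i x n) (r y n) (i y n) (r z n) (i z n))
      ; *-identity =
          (λ x → mk≈ℂ
            (pointwise λ n → identityˡ-re (r x n) (i x n))
            (pointwise λ n → identityˡ-im (r x n) (i x n))) ,
          (λ x → mk≈ℂ
            (pointwise λ n → identityʳ-re (r x n) (i x n))
            (pointwise λ n → identityʳ-im (r x n) (i x n)))
      ; distrib =
          (λ x y z → mk≈ℂ
            (pointwise λ n → distribˡ-re (r x n) (i x n) (r y n) (i y n) (r z n) (i z n))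
            (pointwise λ n → distribˡ-im (r x n) (i x n) (r y n) (i y n) (r z n) (i z n))) ,
          (λ x y z → mk≈ℂ
            (pointwise λ n → distribʳ-re (r x n) (i x n) (r y n) (i y n) (r z n) (i z n))
            (pointwise λ n → distribʳ-im (r x n) (i x n) (r y n) (i y n) (r z n) (i z n)))
      }
    ; *-comm = λ x y → mk≈ℂ
        (pointwise λ n → *-comm-re (r x n) (i x n) (r y n) (i y n))
        (pointwise λ n → *-comm-im (r x n) (i x n) (r y n) (i y n))
    }
  }

open Algebra.Properties.CommutativeMonoid.Sum
  (CommutativeRing.+-commutativeMonoid ℂ-commutativeRing) public using (sum)

open Data.Vec.Functional.Relation.Binary.Equality.Setoid
  (CommutativeRing.setoid ℂ-commutativeRing) public using (_≋_)

-- Row index first.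
Matrix : ℕ → Set
Matrix d = Fin d → Fin d → ℂ

module _ {d : ℕ} where

  infix  4 _≈ₘ_
  infixl 7 _∙ₘ_
  infixr 7 _·_ _∙ᵥ_
  infix  9 _†

  _≈ₘ_ : Matrix d → Matrix d → Set
  M ≈ₘ N = ∀ i j → M i j ≈ℂ N i j

  0ᵥ : Vector ℂ d
  0ᵥ _ = 0ℂ

  _∙ᵥ_ : ℂ → Vector ℂ d → Vector ℂ d
  (c ∙ᵥ ψ) i = c *ℂ ψ i

  _·_ : Matrix d → Vector ℂ d → Vector ℂ d
  (M · ψ) i = sum λ j → M i j *ℂ ψ j

  _∙ₘ_ : Matrix d → Matrix d → Matrix d
  (M ∙ₘ N) i j = sum λ k → M i k *ℂ N k j

  Id : Matrix d
  Id i j with i Fin.≟ j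
  ... | yes _ = 1ℂ
  ... | no  _ = 0ℂ

  _† : Matrix d → Matrix d
  (M †) i j = conj (M j i)

  record IsUnitary (U : Matrix d) : Set where
    field
      U†U≈Id : U † ∙ₘ U ≈ₘ Id
      UU†≈Id : U ∙ₘ U † ≈ₘ Id

  -- The judgement U : A → B of the Heisenberg representation.
  infix 3 _⦂_⟶_
  _⦂_⟶_ : Matrix d → Matrix d → Matrix d → Set
  U ⦂ A ⟶ B = U ∙ₘ A ∙ₘ U † ≈ₘ B

  IsEigenstate : Matrix d → Vector ℂ d → Set
  IsEigenstate N ψ = ¬ (ψ ≋ 0ᵥ) × ∃ λ (c : ℂ) → N · ψ ≋ c ∙ᵥ ψ

-- The index set Fin (2 ^ n) enumerates the computational basis of (ℂ²)^⊗n: the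
-- index i stands for |b₀ … bₙ₋₁⟩, where b = Data.Fin.Base.finToFun i : Fin n → Fin 2.
State : ℕ → Set
State n = Vector ℂ (2 ^ n)

-- Operators are given by their matrices in the computational basis.
Operator : ℕ → Set
Operator n = Matrix (2 ^ n)

{-# OPTIONS --safe #-}
module Submission where

open import Algebra.Bundles using (CommutativeRing)
import Algebra.Properties.CommutativeMonoid.Sum as CommutativeMonoidSum
import Algebra.Properties.Semiring.Sum as SemiringSum
open import Data.Empty using (⊥-elim)
open import Data.Fin.Base using (Fin; punchIn)
open import Data.Fin.Properties using (_≟_; punchInᵢ≢i)
open import Data.Nat.Base using (ℕ; suc)
open import Data.Product.Base using (_,_)
open import Data.Vec.Functional using (Vector; removeAt)
open import Relation.Binary.PropositionalEquality using (_≢_; refl; sym)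
import Relation.Binary.Reasoning.Setoid as SetoidReasoning
open import Relation.Nullary using (yes; no)

open import Defs

private
  module ℂR = CommutativeRing ℂ-commutativeRing

open import Data.Vec.Functional.Relation.Binary.Equality.Setoid ℂR.setoid using (≋-setoid)
open CommutativeMonoidSum ℂR.+-commutativeMonoid
  using (sum-cong-≋; sum-remove; sum-replicate-zero; ∑-comm)
open SemiringSum ℂR.semiring using (*-distribˡ-sum; *-distribʳ-sum)

-- Since U†U = I, the factor U† in B = UAU† cancels the U in Uψ, so B(Uψ) = UA(U†U)ψ = U(Aψ) = U(cψ)
-- = c(Uψ): the eigenvalue c carries over unchanged. The vector Uψ is nonzero because U† undoes U:
-- if Uψ = 0, then ψ = U†(Uψ) = 0. Both halves, `⟶-intertwines` and `·-reflects-0`, rest on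
-- `U†U-cancel`. Matrix equations become equations between vectors through `∙ₘ-·`, which says that
-- the product of matrices acts as composition.

Id-diag : ∀ {d} (i : Fin d) → Id i i ≈ℂ 1ℂ
Id-diag i with i ≟ i
... | yes _   = ℂR.refl
... | no  i≢i = ⊥-elim (i≢i refl)

Id-off-diag : ∀ {d} {i j : Fin d} → i ≢ j → Id i j ≈ℂ 0ℂ
Id-off-diag {i = i} {j} i≢j with i ≟ j
... | yes i≡j = ⊥-elim (i≢j i≡j)
... | no  _   = ℂR.refl

Id-· : ∀ {d} (ψ : Vector ℂ d) → Id · ψ ≋ ψ
-- An index `i` exists only in positive dimension. Splitting off the `i`-th term leaves the
-- off-diagonal ones, all zero.
Id-· {suc d} ψ i = begin
  sum t                        ≈⟨ sum-remove {i = i} t ⟩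
  t i +ℂ sum (removeAt t i)    ≈⟨ ℂR.+-cong (ℂR.*-congʳ (Id-diag i)) (sum-cong-≋ off-diag) ⟩
  1ℂ *ℂ ψ i +ℂ sum (0ᵥ {d})    ≈⟨ ℂR.+-cong (ℂR.*-identityˡ (ψ i)) (sum-replicate-zero d) ⟩
  ψ i +ℂ 0ℂ                    ≈⟨ ℂR.+-identityʳ (ψ i) ⟩
  ψ i                          ∎
  where
  open SetoidReasoning ℂR.setoid
  t : Vector ℂ (suc d)
  t j = Id i j *ℂ ψ j
  off-diag : removeAt t i ≋ 0ᵥ
  off-diag j = ℂR.trans
    (ℂR.*-congʳ (Id-off-diag λ i≡ → punchInᵢ≢i i j (sym i≡)))
    (ℂR.zeroˡ (ψ (punchIn i j)))

module _ {d : ℕ} where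

  ·-congˡ : ∀ (M : Matrix d) {φ ψ : Vector ℂ d} → φ ≋ ψ → M · φ ≋ M · ψ
  ·-congˡ M φ≋ψ i = sum-cong-≋ λ j → ℂR.*-congˡ (φ≋ψ j)

  ·-congʳ : ∀ {M N : Matrix d} (ψ : Vector ℂ d) → M ≈ₘ N → M · ψ ≋ N · ψ
  ·-congʳ ψ M≈N i = sum-cong-≋ λ j → ℂR.*-congʳ (M≈N i j)

  ·-zero : ∀ (M : Matrix d) → M · 0ᵥ ≋ 0ᵥ
  ·-zero M i = ℂR.trans (sum-cong-≋ λ j → ℂR.zeroʳ (M i j)) (sum-replicate-zero d)

  -- Commutativity of ℂ moves `c` past each entry of `M`, and distributivity then pulls it out of
  -- the sum.
  ·-∙ᵥ : ∀ (M : Matrix d) c (ψ : Vector ℂ d) → M · (c ∙ᵥ ψ) ≋ c ∙ᵥ (M · ψ)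
  ·-∙ᵥ M c ψ i = ℂR.trans (sum-cong-≋ reassoc) (ℂR.sym (*-distribˡ-sum c λ j → M i j *ℂ ψ j))
    where
    open SetoidReasoning ℂR.setoid
    reassoc : ∀ j → M i j *ℂ (c *ℂ ψ j) ≈ℂ c *ℂ (M i j *ℂ ψ j)
    reassoc j = begin
      M i j *ℂ (c *ℂ ψ j)    ≈⟨ ℂR.*-assoc (M i j) c (ψ j) ⟨
      M i j *ℂ c *ℂ ψ j      ≈⟨ ℂR.*-congʳ (ℂR.*-comm (M i j) c) ⟩
      c *ℂ M i j *ℂ ψ j      ≈⟨ ℂR.*-assoc c (M i j) (ψ j) ⟩
      c *ℂ (M i j *ℂ ψ j)    ∎

  -- Both sides are the same finite double sum of terms `M i k *ℂ N k j *ℂ ψ j`, taken in the two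
  -- possible orders.
  ∙ₘ-· : ∀ (M N : Matrix d) (ψ : Vector ℂ d) → (M ∙ₘ N) · ψ ≋ M · (N · ψ)
  ∙ₘ-· M N ψ i = begin
    (sum λ j → (sum λ k → M i k *ℂ N k j) *ℂ ψ j)
      ≈⟨ sum-cong-≋ (λ j → *-distribʳ-sum (ψ j) λ k → M i k *ℂ N k j) ⟩
    (sum λ j → sum λ k → M i k *ℂ N k j *ℂ ψ j)
      ≈⟨ ∑-comm (λ j k → M i k *ℂ N k j *ℂ ψ j) ⟩
    (sum λ k → sum λ j → M i k *ℂ N k j *ℂ ψ j)
      ≈⟨ sum-cong-≋ (λ k → sum-cong-≋ λ j → ℂR.*-assoc (M i k) (N k j) (ψ j)) ⟩
    (sum λ k → sum λ j → M i k *ℂ (N k j *ℂ ψ j))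
      ≈⟨ sum-cong-≋ (λ k → *-distribˡ-sum (M i k) λ j → N k j *ℂ ψ j) ⟨
    (sum λ k → M i k *ℂ (sum λ j → N k j *ℂ ψ j)) ∎
    where open SetoidReasoning ℂR.setoid

  module _ {U : Matrix d} (unitary : IsUnitary U) where

    open IsUnitary unitary
    open SetoidReasoning (≋-setoid d)

    U†U-cancel : ∀ ψ → U † · (U · ψ) ≋ ψ
    U†U-cancel ψ = begin
      U † · (U · ψ)   ≈⟨ ∙ₘ-· (U †) U ψ ⟨
      (U † ∙ₘ U) · ψ  ≈⟨ ·-congʳ ψ U†U≈Id ⟩
      Id · ψ          ≈⟨ Id-· ψ ⟩
      ψ               ∎

    -- `U †` is a left inverse and sends zero to zero. The contrapositive is what keeps an
    -- eigenstate nonzero.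
    ·-reflects-0 : ∀ {ψ} → U · ψ ≋ 0ᵥ → ψ ≋ 0ᵥ
    ·-reflects-0 {ψ} Uψ≋0 = begin
      ψ               ≈⟨ U†U-cancel ψ ⟨
      U † · (U · ψ)   ≈⟨ ·-congˡ (U †) Uψ≋0 ⟩
      U † · 0ᵥ        ≈⟨ ·-zero (U †) ⟩
      0ᵥ              ∎

    -- This is the judgement multiplied by U on the right, BU = UA, read on vectors; it holds for
    -- every vector, eigenstate or not.
    ⟶-intertwines : ∀ {A B} → U ⦂ A ⟶ B → ∀ ψ → B · (U · ψ) ≋ U · (A · ψ)
    ⟶-intertwines {A} {B} UAU†≈B ψ = begin
      B · (U · ψ)                   ≈⟨ ·-congʳ (U · ψ) UAU†≈B ⟨
      (U ∙ₘ A ∙ₘ U †) · (U · ψ)     ≈⟨ ∙ₘ-· (U ∙ₘ A) (U †) (U · ψ) ⟩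
      (U ∙ₘ A) · (U † · (U · ψ))    ≈⟨ ·-congˡ (U ∙ₘ A) (U†U-cancel ψ) ⟩
      (U ∙ₘ A) · ψ                  ≈⟨ ∙ₘ-· U A ψ ⟩
      U · (A · ψ)                   ∎

    ⟶-eigenstate : ∀ {A B} → U ⦂ A ⟶ B → ∀ {ψ} → IsEigenstate A ψ → IsEigenstate B (U · ψ)
    ⟶-eigenstate {A} {B} U⦂A⟶B {ψ} (ψ≄0 , c , Aψ≋cψ) =
      -- The eigenvalue `c` of `A` at `ψ` serves again as the witness for `B`.
      (λ Uψ≋0 → ψ≄0 (·-reflects-0 Uψ≋0)) , c , (begin
        B · (U · ψ)    ≈⟨ ⟶-intertwines U⦂A⟶B ψ ⟩
        U · (A · ψ)    ≈⟨ ·-congˡ U Aψ≋cψ ⟩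
        U · (c ∙ᵥ ψ)   ≈⟨ ·-∙ᵥ U c ψ ⟩
        c ∙ᵥ (U · ψ)   ∎)

proposition1 : ∀ (n : ℕ) (U A B : Operator n) → IsUnitary U → U ⦂ A ⟶ B →
    ∀ (ψ : State n) → IsEigenstate A ψ → IsEigenstate B (U · ψ)
proposition1 n U A B unitary U⦂A⟶B ψ = ⟶-eigenstate unitary U⦂A⟶B
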